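{- Let $G_1$ and $G_2$ be abelian groups. If there is a chromatic isomorphism from some connected Cayley graph $\operatorname{Cay}(G_1;S_1)$ of $G_1$ to some Cayley graph $\operatorname{Cay}(G_2;S_2)$ of $G_2$ (with $S_1 \subseteq G_1$ and $S_2 \subseteq G_2$ symmetric), then $G_1$ is isomorphic to $G_2$.
   Context: Groups are abelian, written additively, and may be infinite. A subset $S$ of an abelian group $G$ is symmetric if $S = -S$. For symmetric $S \subseteq G$, the abelian Cayley graph $\operatorname{Cay}(G;S)$ is the undirected graph whose vertices are the elements of $G$, with an edge joining $g$ and $g+s$ for all $g \in G$ and $s \in S$. (It is connected if and only if $S$ generates $G$.) The edge joining $g$ and $g+s$ is coloured with the set $\{\pm s\}$. A graph isomorphism $\varphi$ from an abelian Cayley graph $\operatorname{Cay}(G_1;S_1)$ to an abelian Cayley graph $\operatorname{Cay}(G_2;S_2)$ is chromatic if there is a bijection $\pi \colon S_1 \to S_2$ such that $\varphi(g+s) \in \{\varphi(g) \pm \pi(s)\}$ for all $g \in G_1$ and $s \in S_1$.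
   Formalization: Chromatic also requires that distinct colours {±s} go to distinct colours {±π(s)}; without this the claim fails, e.g. for Z₂×Z₂ with S₁={(1,0),(0,1)} and Z₄ with S₂={1,−1}, whose Cayley graphs are both 4-cycles. -}

module Defs where

open import Level using (suc; _⊔_)
open import Algebra.Bundles using (AbelianGroup)
open import Algebra.Morphism.Structures using (module GroupMorphisms)
open import Data.Product.Base using (Σ; Σ-syntax; ∃-syntax; _×_; _,_; proj₁; proj₂)
open import Data.Sum.Base using (_⊎_)
open import Function.Bundles using (Func; Surjection; Bijection; _⇔_)
open import Relation.Binary.Bundles using (Setoid)
open import Relation.Binary.Core using (Rel)
open import Relation.Binary.Construct.Closure.ReflexiveTransitive using (Star)
import Relation.Binary.Construct.On as On
open import Relation.Binary.Construct.Union using (_∪_)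
open import Relation.Binary.Definitions using (Symmetric; _Respects_; _Respects₂_)
open import Relation.Unary using (Pred; _∈_; _≐_)

-- The axiom of choice: every surjection of sets has a section.  Sets are
-- setoids here, so the content is that the section respects the equalities.

Choice : ∀ a ℓ₁ b ℓ₂ → Set (suc (a ⊔ ℓ₁ ⊔ b ⊔ ℓ₂))
Choice a ℓ₁ b ℓ₂ =
  {A : Setoid a ℓ₁} {B : Setoid b ℓ₂} (f : Surjection A B) →
  Σ[ g ∈ Func B A ] (∀ y → Setoid._≈_ B (Surjection.to f (Func.to g y)) y)

-- Undirected graphs, with loops allowed: Cay(G;S) has them when 0 ∈ S.

record Graph c ℓ e : Set (suc (c ⊔ ℓ ⊔ e)) where
  infix 4 _~_
  field
    vertices : Setoid c ℓ
  open Setoid vertices public using (_≈_) renaming (Carrier to Vertex)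
  field
    _~_      : Rel Vertex e
    ~-sym    : Symmetric _~_
    ~-resp-≈ : _~_ Respects₂ _≈_

-- Walks may also step between ≈-equal representatives of a vertex.

Connected : ∀ {c ℓ e} → Graph c ℓ e → Set (c ⊔ ℓ ⊔ e)
Connected Γ = ∀ x y → Star (_≈_ ∪ _~_) x y
  where open Graph Γ

record GraphIso {c₁ ℓ₁ e₁ c₂ ℓ₂ e₂}
                (Γ₁ : Graph c₁ ℓ₁ e₁) (Γ₂ : Graph c₂ ℓ₂ e₂)
                : Set (c₁ ⊔ ℓ₁ ⊔ e₁ ⊔ c₂ ⊔ ℓ₂ ⊔ e₂) where
  private
    module Γ₁ = Graph Γ₁
    module Γ₂ = Graph Γ₂
  field
    bijection : Bijection Γ₁.vertices Γ₂.vertices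
  open Bijection bijection public using (to)
  field
    adjacent : ∀ x y → x Γ₁.~ y ⇔ to x Γ₂.~ to y

module Additive {c ℓ} (G : AbelianGroup c ℓ) where
  open AbelianGroup G public
    using (Carrier; _≈_; setoid; _-_)
    renaming (_∙_ to infixl 6 _+_; ε to 0#; _⁻¹ to infix 8 -_)

module _ {c ℓ} (G : AbelianGroup c ℓ) where
  open Additive G

  negation : ∀ {p} → Pred Carrier p → Pred Carrier (c ⊔ ℓ ⊔ p)
  negation S x = ∃[ s ] s ∈ S × x ≈ - s

  -- {± s}, the colour of the edges joining g and g + s.
  colour : Carrier → Pred Carrier ℓ
  colour s x = x ≈ s ⊎ x ≈ - s

  record SymmetricSubset p : Set (c ⊔ ℓ ⊔ suc p) where
    field
      member    : Pred Carrier p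
      respects  : member Respects _≈_
      symmetric : member ≐ negation member

    elements : Setoid (c ⊔ p) ℓ
    elements = On.setoid setoid (proj₁ {B = member})

module _ {c ℓ p} (G : AbelianGroup c ℓ) (S : SymmetricSubset G p) where
  open Additive G
  open AbelianGroup G using (sym; trans; ∙-congˡ; ∙-congʳ; assoc; identityʳ; inverseʳ)
  open SymmetricSubset S

  Cay : Graph c ℓ (c ⊔ ℓ ⊔ p)
  Cay = record
    { vertices = setoid
    ; _~_      = λ g h → ∃[ s ] s ∈ member × h ≈ g + s
    ; ~-sym    = λ { {g} {h} (s , s∈S , h≈g+s) →
        - s
      , proj₂ symmetric (s , s∈S , AbelianGroup.refl G)
      , sym (trans (∙-congʳ h≈g+s)
            (trans (assoc g s (- s))
            (trans (∙-congˡ (inverseʳ s)) (identityʳ g)))) }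
    ; ~-resp-≈ =
        (λ { y≈y′ (s , s∈S , y≈x+s) → s , s∈S , trans (sym y≈y′) y≈x+s })
      , (λ { x≈x′ (s , s∈S , y≈x+s) → s , s∈S , trans y≈x+s (∙-congʳ x≈x′) })
    }

-- The field `distinct` says that distinct colours stay distinct, so that π
-- induces a bijection between the colours of the two graphs; the opposite
-- implication, that π maps each colour into a colour, follows from `edges`.
-- A bijection π of connection sets does not give it by itself: for
-- S₁ = {(1,0), (0,1)} in Z₂ × Z₂ and S₂ = {1, -1} in Z₄, the two colours of the
-- first 4-cycle could both go to the single colour of the second, and the
-- groups are not isomorphic.

record Chromatic {c₁ ℓ₁ p₁ c₂ ℓ₂ p₂}
                 (G₁ : AbelianGroup c₁ ℓ₁) (S₁ : SymmetricSubset G₁ p₁)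
                 (G₂ : AbelianGroup c₂ ℓ₂) (S₂ : SymmetricSubset G₂ p₂)
                 (φ : GraphIso (Cay G₁ S₁) (Cay G₂ S₂))
                 : Set (c₁ ⊔ ℓ₁ ⊔ p₁ ⊔ c₂ ⊔ ℓ₂ ⊔ p₂) where
  private
    module G₁ = Additive G₁
    module G₂ = Additive G₂
    module S₁ = SymmetricSubset S₁
    module S₂ = SymmetricSubset S₂
    module φ = GraphIso φ
  field
    π : Bijection S₁.elements S₂.elements

  π′ : Σ G₁.Carrier S₁.member → G₂.Carrier
  π′ s = proj₁ (Bijection.to π s)

  field
    edges : ∀ g s →
      φ.to (g G₁.+ proj₁ s) G₂.≈ φ.to g G₂.+ π′ s
      ⊎ φ.to (g G₁.+ proj₁ s) G₂.≈ φ.to g G₂.- π′ s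
    distinct : ∀ s t →
      colour G₂ (π′ s) ≐ colour G₂ (π′ t) →
      colour G₁ (proj₁ s) ≐ colour G₁ (proj₁ t)

infix 4 _≅_

_≅_ : ∀ {c₁ ℓ₁ c₂ ℓ₂} →
      AbelianGroup c₁ ℓ₁ → AbelianGroup c₂ ℓ₂ → Set (c₁ ⊔ ℓ₁ ⊔ c₂ ⊔ ℓ₂)
G₁ ≅ G₂ = ∃[ f ] IsGroupIsomorphism f
  where
  open GroupMorphisms (AbelianGroup.rawGroup G₁) (AbelianGroup.rawGroup G₂)

{-# OPTIONS --safe #-}
module Submission where

-- Let ψ g = φ g - φ 0.  Along a walk, φ moves by ± π s at each step g → g + s, and the
-- sign can depend on g only if 4 π s = 0, so ± 2 π s does not depend on g.
-- Hence ψ (g + 2h) = ψ g + 2 ψ h, and ψ is additive modulo 2G₂, so ψ restricts to an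
-- isomorphism 2G₁ → 2G₂ and induces an isomorphism G₁/2G₁ → G₂/2G₂.  Although ψ need
-- not be additive, ψ (2x) = 2 ψ x allows x ↦ ψ x to extend any partial homomorphism
-- which agrees with ψ on 2G₁ and is not yet defined at x.  By transfinite iteration
-- there is a total one, and it is bijective by the five lemma.

open import Defs
open import Algebra.Bundles using (AbelianGroup)
open import Axiom.ExcludedMiddle using (ExcludedMiddle)

import Algebra.Properties.AbelianGroup as AbelianGroupProperties
import Algebra.Solver.CommutativeMonoid as CommutativeMonoidSolver
open import Data.Bool.Base using (Bool; T)
open import Data.Product.Base using (Σ; ∃; ∃₂; ∃-syntax; _×_; _,_; proj₁; proj₂)
open import Data.Sum.Base using (_⊎_; inj₁; inj₂)
import Data.Sum.Base as Sum
open import Function.Base using (_∘_; case_of_)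
open import Function.Bundles using (Bijection; Equivalence; Func; Surjection)
open import Function.Definitions using (Congruent; Injective)
open import Level using (_⊔_)
open import Relation.Binary.Bundles using (Poset; Setoid)
open import Relation.Binary.Construct.Closure.ReflexiveTransitive using (Star; _◅_)
  renaming (ε to stop)
import Relation.Binary.Construct.On as On
open import Relation.Binary.Construct.Union using (_∪_)
open import Relation.Binary.Definitions using (_Respects_)
open import Relation.Nullary.Decidable using (yes; no; ⌊_⌋; toWitness; fromWitness)
open import Relation.Nullary.Negation using (¬_; contradiction)
open import Relation.Unary using (Pred; _∈_; _∉_; _≐_)

-- The Bourbaki-Witt fixed-point theorem.

module BourbakiWitt (em : ∀ {ℓ} → ExcludedMiddle ℓ) {c ℓ₁ ℓ₂} (P : Poset c ℓ₁ ℓ₂) where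
  open Poset P

  -- Subsets are Bool-valued, so that the subsets of a type stay in its universe.
  Chain : (Carrier → Bool) → Set (c ⊔ ℓ₂)
  Chain C = ∀ {x y} → T (C x) → T (C y) → x ≤ y ⊎ y ≤ x

  IsSupremum : (Carrier → Bool) → Carrier → Set (c ⊔ ℓ₂)
  IsSupremum C s = (∀ {x} → T (C x) → x ≤ s) × (∀ {u} → (∀ {x} → T (C x) → x ≤ u) → s ≤ u)

  module _
    (sup : ∀ C → ∃ (T ∘ C) → Chain C → ∃ (IsSupremum C))
    (f : Carrier → Carrier) (f-cong : ∀ {x y} → x ≈ y → f x ≈ f y) (x≤fx : ∀ x → x ≤ f x)
    (x₀ : Carrier)
    where

    -- The least set containing `x₀` and closed under `f` and the given suprema of chains. Defining
    -- it inductively replaces transfinite recursion over ordinals.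
    data Tower : Carrier → Set (c ⊔ ℓ₂) where
      base  : Tower x₀
      step  : ∀ {x} → Tower x → Tower (f x)
      limit : ∀ C (inhabited : ∃ (T ∘ C)) (chain : Chain C) → (∀ {x} → T (C x) → Tower x) →
              Tower (proj₁ (sup C inhabited chain))

    tower-above-base : ∀ {y} → Tower y → x₀ ≤ y
    tower-above-base base     = refl
    tower-above-base (step t) = trans (tower-above-base t) (x≤fx _)
    tower-above-base (limit C (x , x∈C) chain ts) =
      trans (tower-above-base (ts x∈C)) (proj₁ (proj₂ (sup C (x , x∈C) chain)) x∈C)

    -- The extreme elements of the classical proof. Comparability is first shown with an extreme
    -- element; that every tower element is extreme follows from it afterwards.
    Extreme : Carrier → Set (c ⊔ ℓ₁ ⊔ ℓ₂)
    Extreme x = ∀ {y} → Tower y → y ≤ x → ¬ (y ≈ x) → f y ≤ x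

    bounded-or-exceeded : ∀ (C : Carrier → Bool) x →
      (∀ {y} → T (C y) → y ≤ x) ⊎ (∃[ y ] T (C y) × ¬ (y ≤ x))
    bounded-or-exceeded C x = case em {P = ∃[ y ] T (C y) × ¬ (y ≤ x)} of λ where
      (yes exceeded)  → inj₂ exceeded
      (no ¬exceeded) → inj₁ λ {y} y∈C → case em {P = y ≤ x} of λ where
        (yes y≤x) → y≤x
        (no y≰x)  → contradiction (y , y∈C , y≰x) ¬exceeded

    -- Induction on `y`. Extremeness keeps `f` from jumping over `x`. A supremum stays below `x` if
    -- all members of the chain do; otherwise some member is above `f x`, and so is the supremum.
    extreme-comparable : ∀ {x y} → Tower x → Extreme x → Tower y → y ≤ x ⊎ f x ≤ y
    extreme-comparable tx ex base = inj₁ (tower-above-base tx)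
    extreme-comparable {x} tx ex (step {y} ty) with extreme-comparable tx ex ty
    ... | inj₂ fx≤y = inj₂ (trans fx≤y (x≤fx y))
    ... | inj₁ y≤x  = case em {P = y ≈ x} of λ where
      (yes y≈x) → inj₂ (reflexive (f-cong (Eq.sym y≈x)))
      (no y≉x)  → inj₁ (ex ty y≤x y≉x)
    extreme-comparable {x} tx ex (limit C inhabited chain ts) with bounded-or-exceeded C x
    ... | inj₁ bounded           = inj₁ (proj₂ (proj₂ (sup C inhabited chain)) bounded)
    ... | inj₂ (y , y∈C , y≰x) with extreme-comparable tx ex (ts y∈C)
    ...   | inj₁ y≤x  = contradiction y≤x y≰x
    ...   | inj₂ fx≤y = inj₂ (trans fx≤y (proj₁ (proj₂ (sup C inhabited chain)) y∈C))

    -- Induction on `x`, comparing `y` with elements already known to be extreme. If `y` is strictly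
    -- below a supremum, it is no upper bound of the chain, so it lies strictly below some member,
    -- to which the induction hypothesis applies.
    tower-extreme : ∀ {x} → Tower x → Extreme x
    tower-extreme base ty y≤x₀ y≉x₀ = contradiction (antisym y≤x₀ (tower-above-base ty)) y≉x₀
    tower-extreme (step {x} tx) {y} ty y≤fx y≉fx
      with extreme-comparable tx (tower-extreme tx) ty
    ... | inj₂ fx≤y = contradiction (antisym y≤fx fx≤y) y≉fx
    ... | inj₁ y≤x  = case em {P = y ≈ x} of λ where
      (yes y≈x) → reflexive (f-cong y≈x)
      (no y≉x)  → trans (tower-extreme tx ty y≤x y≉x) (x≤fx x)
    tower-extreme (limit C inhabited chain ts) {y} ty y≤s y≉s
      with sup C inhabited chain | bounded-or-exceeded C y
    ... | s , upper , least | inj₁ bounded = contradiction (antisym y≤s (least bounded)) y≉s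
    ... | s , upper , least | inj₂ (x , x∈C , x≰y)
      with extreme-comparable (ts x∈C) (tower-extreme (ts x∈C)) ty
    ...   | inj₁ y≤x  = trans (tower-extreme (ts x∈C) ty y≤x (x≰y ∘ reflexive ∘ Eq.sym)) (upper x∈C)
    ...   | inj₂ fx≤y = contradiction (trans (x≤fx x) fx≤y) x≰y

    tower-total : ∀ {x y} → Tower x → Tower y → x ≤ y ⊎ y ≤ x
    tower-total {x} tx ty =
      Sum.swap (Sum.map₂ (trans (x≤fx x)) (extreme-comparable tx (tower-extreme tx) ty))

    -- The tower is a chain, so its supremum belongs to it. Then `f` of the supremum belongs to it
    -- too and cannot exceed the supremum.
    fixed-point : ∃[ x ] x₀ ≤ x × f x ≤ x
    fixed-point = top , tower-above-base tower-top , upper (fromWitness (step tower-top))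
      where
      tower : Carrier → Bool
      tower x = ⌊ em {P = Tower x} ⌋

      tower-sup : ∃ (IsSupremum tower)
      tower-sup = sup tower (x₀ , fromWitness base) (λ x∈ y∈ → tower-total (toWitness x∈) (toWitness y∈))

      top   = proj₁ tower-sup
      upper = proj₁ (proj₂ tower-sup)

      tower-top : Tower top
      tower-top = limit _ _ _ toWitness

-- Calculation in abelian groups.

module GroupCalculus {c ℓ} (G : AbelianGroup c ℓ) where
  open AbelianGroup G public
  open Additive G public using (_+_; 0#; -_)
  open AbelianGroupProperties G public
    using (∙-cancelˡ; ∙-cancelʳ; inverseˡ-unique; inverseʳ-unique; ⁻¹-involutive; ⁻¹-∙-comm;
           x∙y⁻¹≈ε⇒x≈y; x≈y⇒x∙y⁻¹≈ε; //-rightDividesʳ)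
  open CommutativeMonoidSolver commutativeMonoid public using (solve; _⊜_; _⊕_; id)

  -- Derives x ≈ y from hypotheses collected in u ≈ v: what is left is then an
  -- identity of commutative monoids.
  cancel : ∀ {x y u v} → u ≈ v → x + u ≈ y + v → x ≈ y
  cancel {x} {y} {u} {v} u≈v eq = ∙-cancelʳ v x y (trans (∙-congˡ (sym u≈v)) eq)

  -- If `x` lies in a subgroup containing all doubles, this puts `- (x + y)` back into the coset of
  -- `y`, as needed when a homomorphism is extended by one element.
  neg-shift : ∀ x y → - (x + y) ≈ - x + - (y + y) + y
  neg-shift x y = cancel
    (trans (∙-cong (inverseʳ x) (inverseʳ (y + y)))
      (trans (identityˡ ε) (sym (inverseʳ (x + y)))))
    (solve 5 (λ a b a⁻ c⁻ d⁻ →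
        d⁻ ⊕ ((a ⊕ a⁻) ⊕ ((b ⊕ b) ⊕ c⁻)) ⊜ ((a⁻ ⊕ c⁻) ⊕ b) ⊕ ((a ⊕ b) ⊕ d⁻))
      refl x y (- x) (- (y + y)) (- (x + y)))

-- Partial homomorphisms that follow a given map modulo doubles.

module Straightening
  (em : ∀ {ℓ} → ExcludedMiddle ℓ) (choice : ∀ {a ℓ₁ b ℓ₂} → Choice a ℓ₁ b ℓ₂)
  {c₁ ℓ₁ c₂ ℓ₂} (G : AbelianGroup c₁ ℓ₁) (H : AbelianGroup c₂ ℓ₂)
  where

  private
    module G = GroupCalculus G
    module H = GroupCalculus H

  module _
    (φ : G.Carrier → H.Carrier)
    (φ-cong : Congruent G._≈_ H._≈_ φ)
    (φ-injective : Injective G._≈_ H._≈_ φ)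
    (φ-surjective : ∀ y → ∃[ x ] φ x H.≈ y)
    (φ-0 : φ G.0# H.≈ H.0#)
    (φ-twice : ∀ h → φ (h G.+ h) H.≈ φ h H.+ φ h)
    (φ-homo-twice : ∀ g h → φ (g G.+ (h G.+ h)) H.≈ φ g H.+ φ (h G.+ h))
    (φ-near-homo : ∀ g h → ∃[ w ] φ (g G.+ h) H.≈ φ g H.+ φ h H.+ (w H.+ w))
    where

    -- Encoded as a subgroup of G × H, so `functional` at 0 gives single-valuedness everywhere by
    -- taking differences. With Bool values, a union of partial homomorphisms stays in the same
    -- universe.
    record PartialHom : Set (c₁ ⊔ ℓ₁ ⊔ c₂ ⊔ ℓ₂) where
      field
        graph : G.Carrier → H.Carrier → Bool

      infix 4 _↦_
      _↦_ : G.Carrier → H.Carrier → Set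
      x ↦ y = T (graph x y)

      field
        resp       : ∀ {x x′ y y′} → x G.≈ x′ → y H.≈ y′ → x ↦ y → x′ ↦ y′
        +-closed   : ∀ {x x′ y y′} → x ↦ y → x′ ↦ y′ → x G.+ x′ ↦ y H.+ y′
        neg-closed : ∀ {x y} → x ↦ y → G.- x ↦ H.- y
        functional : ∀ {x y} → x G.≈ G.0# → x ↦ y → y H.≈ H.0#
        -- The next two fields tie the relation to φ: it agrees with φ on 2G, and it lies
        -- over the isomorphism G/2G → H/2H induced by φ, which makes it injective and,
        -- once total, surjective.
        twice      : ∀ g → g G.+ g ↦ φ (g G.+ g)
        near-φ     : ∀ {x y} → x ↦ y → ∃[ w ] y H.≈ φ x H.+ (w H.+ w)

      dom : Pred G.Carrier c₂
      dom x = ∃[ y ] x ↦ y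

      zero↦zero : G.0# ↦ H.0#
      zero↦zero = resp (G.identityˡ _) (H.trans (φ-cong (G.identityˡ _)) φ-0) (twice G.0#)

    open PartialHom using (graph)

    infix 4 _⊑_
    _⊑_ : PartialHom → PartialHom → Set (c₁ ⊔ c₂)
    R ⊑ R′ = ∀ {x y} → x R.↦ y → x R′.↦ y
      where
      module R  = PartialHom R
      module R′ = PartialHom R′

    partialHoms : Poset _ _ _
    partialHoms = record
      { Carrier = PartialHom
      ; _≈_ = λ R R′ → R ⊑ R′ × R′ ⊑ R
      ; _≤_ = _⊑_
      ; isPartialOrder = record
        { isPreorder = record
          { isEquivalence = record
            { refl  = (λ p → p) , (λ p → p)
            ; sym   = λ (f , g) → (λ p → g p) , (λ p → f p)
            ; trans = λ (f , g) (f′ , g′) → (λ p → f′ (f p)) , (λ p → g (g′ p))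
            }
          ; reflexive = λ (f , _) p → f p
          ; trans = λ f g p → g (f p)
          }
        ; antisym = λ f g → (λ p → f p) , (λ p → g p)
        }
      }

    open Poset partialHoms using () renaming (_≈_ to _≐ʰ_)
    open BourbakiWitt em partialHoms using (Chain; IsSupremum; fixed-point)

    -- The start of the iteration: `φ` restricted to 2G, where `φ-homo-twice` makes it additive.
    doubling : PartialHom
    doubling = record
      { graph      = λ x y → ⌊ em {P = Doubling x y} ⌋
      ; resp       = λ x≈ y≈ p → let g , x≈2g , y≈φx = toWitness p in fromWitness
          (g , G.trans (G.sym x≈) x≈2g , H.trans (H.sym y≈) (H.trans y≈φx (φ-cong x≈)))
      ; +-closed   = λ p q → fromWitness (+-closed′ (toWitness p) (toWitness q))
      ; neg-closed = λ p → fromWitness (neg-closed′ (toWitness p))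
      ; functional = λ x≈0 p → let _ , _ , y≈φx = toWitness p in
          H.trans y≈φx (H.trans (φ-cong x≈0) φ-0)
      ; twice      = λ g → fromWitness (g , G.refl , H.refl)
      ; near-φ     = λ p → let _ , _ , y≈φx = toWitness p in
          H.0# , H.cancel (H.sym y≈φx) (H.solve 2 (λ y φx → y ⊕ φx ⊜ (φx ⊕ (id ⊕ id)) ⊕ y) H.refl _ _)
      }
      where
      open H using (_⊜_; _⊕_; id)

      Doubling : G.Carrier → H.Carrier → Set _
      Doubling x y = ∃[ g ] x G.≈ g G.+ g × y H.≈ φ x

      φ-+-twice : ∀ {x y} g → y G.≈ g G.+ g → φ (x G.+ y) H.≈ φ x H.+ φ y
      φ-+-twice g y≈2g = H.trans (φ-cong (G.∙-congˡ y≈2g))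
        (H.trans (φ-homo-twice _ g) (H.∙-congˡ (φ-cong (G.sym y≈2g))))

      +-closed′ : ∀ {x x′ y y′} → Doubling x y → Doubling x′ y′ → Doubling (x G.+ x′) (y H.+ y′)
      +-closed′ (g , x≈2g , y≈φx) (g′ , x′≈2g′ , y′≈φx′) =
        g G.+ g′ ,
        G.trans (G.∙-cong x≈2g x′≈2g′)
          (G.solve 2 (λ a b → (a G.⊕ a) G.⊕ (b G.⊕ b) G.⊜ (a G.⊕ b) G.⊕ (a G.⊕ b)) G.refl _ _) ,
        H.trans (H.∙-cong y≈φx y′≈φx′) (H.sym (φ-+-twice g′ x′≈2g′))

      neg-closed′ : ∀ {x y} → Doubling x y → Doubling (G.- x) (H.- y)
      neg-closed′ {x} (g , x≈2g , y≈φx) =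
        G.- g , -x≈ , H.trans (H.⁻¹-cong y≈φx) (H.sym (H.inverseˡ-unique _ _ φ-x))
        where
        -x≈ : G.- x G.≈ G.- g G.+ G.- g
        -x≈ = G.trans (G.⁻¹-cong x≈2g) (G.sym (G.⁻¹-∙-comm g g))

        φ-x : φ (G.- x) H.+ φ x H.≈ H.0#
        φ-x = H.trans (H.sym (φ-+-twice g x≈2g)) (H.trans (φ-cong (G.inverseˡ x)) φ-0)

    -- Extension by one element.

    module Extend (R : PartialHom) (x₀ : G.Carrier) (x₀∉ : x₀ ∉ PartialHom.dom R) where
      open PartialHom R
      open H using (_⊜_; _⊕_; id)

      -- The domain A of `R` contains 2G and hence `x₀ + x₀`, so A and the coset A + `x₀` already
      -- make up the subgroup generated by A and `x₀`.
      Shifted : G.Carrier → H.Carrier → Set _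
      Shifted x y = ∃₂ λ u v → u ↦ v × x G.≈ u G.+ x₀ × y H.≈ v H.+ φ x₀

      Extended : G.Carrier → H.Carrier → Set _
      Extended x y = x ↦ y ⊎ Shifted x y

      extended-+ : ∀ {x x′ y y′} → Extended x y → Extended x′ y′ → Extended (x G.+ x′) (y H.+ y′)
      extended-+ (inj₁ p) (inj₁ q) = inj₁ (+-closed p q)
      extended-+ (inj₁ p) (inj₂ (u , v , u↦v , x≈ , y≈)) = inj₂
        (_ , _ , +-closed p u↦v ,
         G.trans (G.∙-congˡ x≈) (G.sym (G.assoc _ _ _)) ,
         H.trans (H.∙-congˡ y≈) (H.sym (H.assoc _ _ _)))
      extended-+ (inj₂ (u , v , u↦v , x≈ , y≈)) (inj₁ q) = inj₂
        (_ , _ , +-closed q u↦v ,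
         G.trans (G.∙-congʳ x≈) (G.trans (G.comm _ _) (G.sym (G.assoc _ _ _))) ,
         H.trans (H.∙-congʳ y≈) (H.trans (H.comm _ _) (H.sym (H.assoc _ _ _))))
      -- The two shifts add up to `x₀ + x₀`, which `R` sends to `φ (x₀ + x₀)`. This is the required
      -- value because `φ` doubles it to `φ x₀ + φ x₀`.
      extended-+ (inj₂ (u , v , u↦v , x≈ , y≈)) (inj₂ (u′ , v′ , u′↦v′ , x′≈ , y′≈)) = inj₁
        (resp
          (G.trans
            (G.solve 3 (λ a b c → (a G.⊕ b) G.⊕ (c G.⊕ c) G.⊜ (a G.⊕ c) G.⊕ (b G.⊕ c)) G.refl _ _ _)
            (G.sym (G.∙-cong x≈ x′≈)))
          (H.trans (H.∙-congˡ (φ-twice x₀)) (H.trans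
            (H.solve 3 (λ a b c → (a ⊕ b) ⊕ (c ⊕ c) ⊜ (a ⊕ c) ⊕ (b ⊕ c)) H.refl _ _ _)
            (H.sym (H.∙-cong y≈ y′≈))))
          (+-closed (+-closed u↦v u′↦v′) (twice x₀)))

      extended-neg : ∀ {x y} → Extended x y → Extended (G.- x) (H.- y)
      extended-neg (inj₁ p) = inj₁ (neg-closed p)
      extended-neg (inj₂ (u , v , u↦v , x≈ , y≈)) = inj₂
        (_ , _ , +-closed (neg-closed u↦v) (neg-closed (twice x₀)) ,
         G.trans (G.⁻¹-cong x≈) (G.neg-shift u x₀) ,
         H.trans (H.⁻¹-cong y≈) (H.trans (H.neg-shift v (φ x₀))
           (H.∙-congʳ (H.∙-congˡ (H.⁻¹-cong (H.sym (φ-twice x₀)))))))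

      extended-functional : ∀ {x y} → x G.≈ G.0# → Extended x y → y H.≈ H.0#
      extended-functional x≈0 (inj₁ p) = functional x≈0 p
      -- A shifted pair over 0 would give `x₀ = - u`, an element of the domain of `R`.
      extended-functional x≈0 (inj₂ (u , v , u↦v , x≈ , _)) = contradiction
        (_ , resp (G.sym (G.inverseʳ-unique u x₀ (G.trans (G.sym x≈) x≈0))) H.refl (neg-closed u↦v)) x₀∉

      extended-near-φ : ∀ {x y} → Extended x y → ∃[ w ] y H.≈ φ x H.+ (w H.+ w)
      extended-near-φ (inj₁ p) = near-φ p
      extended-near-φ {x} {y} (inj₂ (u , v , u↦v , x≈ , y≈)) with near-φ u↦v | φ-near-homo u x₀
      -- From v = φ u + 2w and φ (u + x₀) = φ u + φ x₀ + 2w′ one gets v + φ x₀ = φ (u + x₀) + 2(w -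
      -- w′).
      ... | w , v≈ | w′ , φ≈ = w H.+ H.- w′ , H.cancel
        (H.∙-cong (H.sym y≈) (H.∙-cong (H.sym v≈)
          (H.∙-cong (H.trans (φ-cong x≈) φ≈) (H.∙-cong (H.inverseʳ w′) (H.inverseʳ w′)))))
        (H.solve 8 (λ y v φx₀ φu φx w w′ w⁻ →
            y ⊕ ((v ⊕ φx₀) ⊕ ((φu ⊕ (w ⊕ w)) ⊕ (φx ⊕ ((w′ ⊕ w⁻) ⊕ (w′ ⊕ w⁻))))) ⊜
            (φx ⊕ ((w ⊕ w⁻) ⊕ (w ⊕ w⁻))) ⊕ (y ⊕ (v ⊕ (((φu ⊕ φx₀) ⊕ (w′ ⊕ w′)) ⊕ (id ⊕ id)))))
          H.refl y v (φ x₀) (φ u) (φ x) w w′ (H.- w′))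

      extended : PartialHom
      extended = record
        { graph      = λ x y → ⌊ em {P = Extended x y} ⌋
        ; resp       = λ x≈ y≈ p → fromWitness (Sum.map (resp x≈ y≈)
            (λ (u , v , u↦v , x≈′ , y≈′) →
              u , v , u↦v , G.trans (G.sym x≈) x≈′ , H.trans (H.sym y≈) y≈′)
            (toWitness p))
        ; +-closed   = λ p q → fromWitness (extended-+ (toWitness p) (toWitness q))
        ; neg-closed = λ p → fromWitness (extended-neg (toWitness p))
        ; functional = λ x≈0 p → extended-functional x≈0 (toWitness p)
        ; twice      = λ g → fromWitness (inj₁ (twice g))
        ; near-φ     = λ p → extended-near-φ (toWitness p)
        }

      x₀∈extended : x₀ ∈ PartialHom.dom extended
      x₀∈extended = φ x₀ , fromWitness
        (inj₂ (_ , _ , zero↦zero , G.sym (G.identityˡ _) , H.sym (H.identityˡ _)))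

    -- Applied in both directions, this lets `enlarge` respect equality of partial homomorphisms.
    extended-mono : ∀ R R′ {x₀ x₀′} x₀∉ x₀′∉ → R ⊑ R′ → x₀ G.≈ x₀′ →
      Extend.extended R x₀ x₀∉ ⊑ Extend.extended R′ x₀′ x₀′∉
    extended-mono _ _ _ _ R⊑R′ x₀≈x₀′ p = fromWitness (Sum.map R⊑R′
      (λ (u , v , u↦v , x≈ , y≈) → u , v , R⊑R′ u↦v ,
        G.trans x≈ (G.∙-congˡ x₀≈x₀′) , H.trans y≈ (H.∙-congˡ (φ-cong x₀≈x₀′)))
      (toWitness p))

    -- Unions of chains.

    module ChainUnion (C : PartialHom → Bool) (inhabited : ∃ (T ∘ C)) (chain : Chain C) where
      open PartialHom

      Union : G.Carrier → H.Carrier → Set _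
      Union x y = ∃[ R ] T (C R) × T (graph R x y)

      union-+ : ∀ {x x′ y y′} → Union x y → Union x′ y′ → Union (x G.+ x′) (y H.+ y′)
      union-+ (R , R∈C , p) (R′ , R′∈C , q) with chain R∈C R′∈C
      ... | inj₁ R⊑R′ = R′ , R′∈C , +-closed R′ (R⊑R′ p) q
      ... | inj₂ R′⊑R = R , R∈C , +-closed R p (R′⊑R q)

      union : PartialHom
      union = record
        { graph      = λ x y → ⌊ em {P = Union x y} ⌋
        ; resp       = λ x≈ y≈ p → let R , R∈C , q = toWitness p in
            fromWitness (R , R∈C , resp R x≈ y≈ q)
        ; +-closed   = λ p q → fromWitness (union-+ (toWitness p) (toWitness q))
        ; neg-closed = λ p → let R , R∈C , q = toWitness p in
            fromWitness (R , R∈C , neg-closed R q)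
        ; functional = λ x≈0 p → let R , R∈C , q = toWitness p in functional R x≈0 q
        -- An empty union would miss the doubles; any member of the chain supplies them.
        ; twice      = λ g → let R , R∈C = inhabited in fromWitness (R , R∈C , twice R g)
        ; near-φ     = λ p → let R , R∈C , q = toWitness p in near-φ R q
        }

      union-supremum : IsSupremum C union
      union-supremum =
        (λ R∈C p → fromWitness (_ , R∈C , p)) ,
        (λ upper p → let R , R∈C , q = toWitness p in upper R∈C q)

    -- Choice of missing elements and transfinite iteration.

    Incomplete : PartialHom → Set _
    Incomplete R = ∃[ x ] x ∉ PartialHom.dom R

    incompletes : Setoid _ _
    incompletes = On.setoid (Poset.Eq.setoid partialHoms) (proj₁ {B = Incomplete})

    incompletes-with-witness : Setoid _ _
    incompletes-with-witness = record
      { Carrier = ∃ Incomplete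
      ; _≈_ = λ (R , x , _) (R′ , x′ , _) → R ≐ʰ R′ × x G.≈ x′
      ; isEquivalence = record
        { refl  = λ {(R , _)} → Poset.Eq.refl partialHoms {R} , G.refl
        ; sym   = λ {(R , _)} {(R′ , _)} (e , x≈) → Poset.Eq.sym partialHoms {R} {R′} e , G.sym x≈
        ; trans = λ {(R , _)} {(R′ , _)} {(R″ , _)} (e , x≈) (e′ , x≈′) →
            Poset.Eq.trans partialHoms {R} {R′} {R″} e e′ , G.trans x≈ x≈′
        }
      }

    -- An `Incomplete` proof already carries a missing element, but equal relations may carry
    -- different ones. A section of this map chooses one that depends only on the equality class.
    forget-witness : Surjection incompletes-with-witness incompletes
    forget-witness = record
      { to         = λ p → p
      ; cong       = λ (e , _) → e
      ; surjective = λ p → p , λ (e , _) → e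
      }

    choose : Func incompletes incompletes-with-witness
    choose = proj₁ (choice forget-witness)

    missing : ∀ R → Incomplete R → G.Carrier
    missing R n = proj₁ (proj₂ (Func.to choose (R , n)))

    missing∉ : ∀ R n → missing R n ∉ PartialHom.dom R
    -- The section may return another relation, equal to `R`, so the pair is carried over to it.
    missing∉ R n (y , p) = proj₂ (proj₂ (Func.to choose (R , n)))
      (y , proj₂ (proj₂ (choice forget-witness) (R , n)) p)

    enlarge : PartialHom → PartialHom
    enlarge R = case em {P = Incomplete R} of λ where
      (yes n) → Extend.extended R (missing R n) (missing∉ R n)
      (no _)  → R

    enlarge-cong : ∀ {R R′} → R ≐ʰ R′ → enlarge R ≐ʰ enlarge R′
    enlarge-cong {R} {R′} e@(R⊑R′ , R′⊑R) with em {P = Incomplete R} | em {P = Incomplete R′}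
    ... | yes n       | yes n′       =
      extended-mono R R′ (missing∉ R n) (missing∉ R′ n′) R⊑R′ x≈ ,
      extended-mono R′ R (missing∉ R′ n′) (missing∉ R n) R′⊑R (G.sym x≈)
      where
      x≈ : missing R n G.≈ missing R′ n′
      x≈ = proj₂ (Func.cong choose {R , n} {R′ , n′} e)
    ... | no _        | no _         = e
    ... | yes (x , x∉) | no ¬n′      =
      contradiction (x , λ (y , p) → x∉ (y , R′⊑R p)) ¬n′
    ... | no ¬n       | yes (x , x∉) =
      contradiction (x , λ (y , p) → x∉ (y , R⊑R′ p)) ¬n

    enlarge-inflationary : ∀ R → R ⊑ enlarge R
    enlarge-inflationary R p with em {P = Incomplete R}
    ... | yes _ = fromWitness (inj₁ p)
    ... | no _  = p

    enlarge-fixed⇒total : ∀ R → enlarge R ⊑ R → ∀ x → x ∈ PartialHom.dom R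
    enlarge-fixed⇒total R fixed x with em {P = Incomplete R}
    ... | yes n = contradiction (_ , fixed (proj₂ (Extend.x₀∈extended R _ (missing∉ R n)))) (missing∉ R n)
    ... | no ¬n = case em {P = x ∈ PartialHom.dom R} of λ where
      (yes x∈) → x∈
      (no x∉)  → contradiction (x , x∉) ¬n

    total-hom : ∃[ R ] (∀ x → x ∈ PartialHom.dom R)
    total-hom =
      let R , _ , fixed = fixed-point
            (λ C inhabited chain → let open ChainUnion C inhabited chain in union , union-supremum)
            enlarge (λ {R} {R′} → enlarge-cong {R} {R′}) enlarge-inflationary doubling
      in R , enlarge-fixed⇒total R fixed

    -- Bijectivity of a total homomorphism.

    total-hom⇒≅ : (R : PartialHom) → (∀ x → x ∈ PartialHom.dom R) → G ≅ H
    total-hom⇒≅ R total = ψ , record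
      { isGroupMonomorphism = record
        { isGroupHomomorphism = record
          { isMonoidHomomorphism = record
            { isMagmaHomomorphism = record
              { isRelHomomorphism = record { cong = λ {x} {x′} x≈ → unique x≈ (ψ-graph x) (ψ-graph x′) }
              ; homo = λ x y → unique G.refl (ψ-graph (x G.+ y)) (+-closed (ψ-graph x) (ψ-graph y))
              }
            ; ε-homo = functional G.refl (ψ-graph G.0#)
            }
          ; ⁻¹-homo = λ x → unique G.refl (ψ-graph (G.- x)) (neg-closed (ψ-graph x))
          }
        ; injective = λ {x} {x′} ψx≈ψx′ → G.x∙y⁻¹≈ε⇒x≈y x x′
            (kernel-trivial (H.x≈y⇒x∙y⁻¹≈ε ψx≈ψx′)
              (+-closed (ψ-graph x) (neg-closed (ψ-graph x′))))
        }
      ; surjective = λ y → let x , x↦y = onto y in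
          x , λ {z} z≈x → unique z≈x (ψ-graph z) x↦y
      }
      where
      open PartialHom R
      open H using (_⊜_; _⊕_; id)

      ψ : G.Carrier → H.Carrier
      ψ x = proj₁ (total x)

      ψ-graph : ∀ x → x ↦ ψ x
      ψ-graph x = proj₂ (total x)

      unique : ∀ {x x′ y y′} → x G.≈ x′ → x ↦ y → x′ ↦ y′ → y H.≈ y′
      unique {x} {x′} {y} {y′} x≈x′ p p′ = H.x∙y⁻¹≈ε⇒x≈y y y′
        (functional (G.x≈y⇒x∙y⁻¹≈ε x≈x′) (+-closed p (neg-closed p′)))

      φ-onto-twice : ∀ w → ∃[ g ] φ (g G.+ g) H.≈ w H.+ w
      φ-onto-twice w = let g , φg≈w = φ-surjective w in
        g , H.trans (φ-twice g) (H.∙-cong φg≈w φg≈w)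

      -- If `y` vanishes, then `φ x` is a double by `near-φ`, so `x` is a double by injectivity of
      -- `φ`. On doubles the relation agrees with `φ`, whence `φ x` = 0.
      kernel-trivial : ∀ {x y} → y H.≈ H.0# → x ↦ y → x G.≈ G.0#
      kernel-trivial {x} {y} y≈0 x↦y with near-φ x↦y
      ... | w , y≈ with φ-onto-twice (H.- w)
      ...   | g , φ2g≈ = φ-injective (H.trans φx≈φ2g (H.trans φ2g≈0 (H.sym φ-0)))
        where
        φx≈φ2g : φ x H.≈ φ (g G.+ g)
        φx≈φ2g = H.cancel
          (H.∙-cong y≈ (H.∙-cong (H.sym y≈0) (H.∙-cong φ2g≈
            (H.∙-cong (H.inverseʳ w) (H.inverseʳ w)))))
          (H.solve 5 (λ φx φ2g y w w⁻ →
              φx ⊕ (y ⊕ (id ⊕ (φ2g ⊕ ((w ⊕ w⁻) ⊕ (w ⊕ w⁻))))) ⊜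
              φ2g ⊕ ((φx ⊕ (w ⊕ w)) ⊕ (y ⊕ ((w⁻ ⊕ w⁻) ⊕ (id ⊕ id)))))
            H.refl (φ x) (φ (g G.+ g)) y w (H.- w))

        φ2g≈0 : φ (g G.+ g) H.≈ H.0#
        φ2g≈0 = H.trans (unique (φ-injective (H.sym φx≈φ2g)) (twice g) x↦y) y≈0

      -- A `φ`-preimage of `y` is mapped to `y` up to some 2w, and adding a double with image -2w
      -- corrects the error.
      onto : ∀ y → ∃[ x ] x ↦ y
      onto y with φ-surjective y
      ... | x , φx≈y with near-φ (ψ-graph x)
      ...   | w , ψx≈ with φ-onto-twice (H.- w)
      ...     | g , φ2g≈ = x G.+ (g G.+ g) , resp G.refl ψx+φ2g≈y (+-closed (ψ-graph x) (twice g))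
        where
        ψx+φ2g≈y : ψ x H.+ φ (g G.+ g) H.≈ y
        ψx+φ2g≈y = H.cancel
          (H.∙-cong (H.sym ψx≈) (H.∙-cong (H.sym φ2g≈) (H.∙-cong (H.sym φx≈y)
            (H.sym (H.∙-cong (H.inverseʳ w) (H.inverseʳ w))))))
          (H.solve 6 (λ φx ψx φ2g y w w⁻ →
              (ψx ⊕ φ2g) ⊕ ((φx ⊕ (w ⊕ w)) ⊕ ((w⁻ ⊕ w⁻) ⊕ (y ⊕ (id ⊕ id)))) ⊜
              y ⊕ (ψx ⊕ (φ2g ⊕ (φx ⊕ ((w ⊕ w⁻) ⊕ (w ⊕ w⁻))))))
            H.refl (φ x) (ψ x) (φ (g G.+ g)) y w (H.- w))

    straighten : G ≅ H
    straighten = let R , total = total-hom in total-hom⇒≅ R total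

-- Chromatic isomorphisms: signs along edges.

module ChromaticIso
  {c₁ ℓ₁ c₂ ℓ₂ p₁ p₂} (G₁ : AbelianGroup c₁ ℓ₁) (G₂ : AbelianGroup c₂ ℓ₂)
  (S₁ : SymmetricSubset G₁ p₁) (S₂ : SymmetricSubset G₂ p₂)
  (connected : Connected (Cay G₁ S₁))
  (φ : GraphIso (Cay G₁ S₁) (Cay G₂ S₂)) (chromatic : Chromatic G₁ S₁ G₂ S₂ φ)
  where

  private
    module G = GroupCalculus G₁
    module H = GroupCalculus G₂
    module S₁ = SymmetricSubset S₁
    module S₂ = SymmetricSubset S₂
    module φ where
      open GraphIso φ public
      open Bijection bijection public using (cong; injective; surjective)

    F : G.Carrier → H.Carrier
    F = φ.to

  open H using (_⊜_; _⊕_; id)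
  open Chromatic chromatic using (π; π′; edges; distinct)

  Generator : Set _
  Generator = Σ G.Carrier S₁.member

  -- Connectedness as an induction principle. Respect for equality is needed because walks may step
  -- between representatives and edges fix their ends only up to equality.
  walk-induction : ∀ {k} (K : Pred G.Carrier k) → K Respects G._≈_ → K G.0# →
    (∀ {g} (s : Generator) → K g → K (g G.+ proj₁ s)) → ∀ g → K g
  walk-induction K resp K0 K+ g = along (connected G.0# g) K0
    where
    along : ∀ {x y} → Star (G._≈_ ∪ Graph._~_ (Cay G₁ S₁)) x y → K x → K y
    along stop Kx                               = Kx
    along (inj₁ x≈y ◅ walk) Kx                  = along walk (resp x≈y Kx)
    along (inj₂ (s , s∈S , y≈x+s) ◅ walk) Kx = along walk (resp (G.sym y≈x+s) (K+ (s , s∈S) Kx))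

  F-surjective : ∀ y → ∃[ x ] F x H.≈ y
  F-surjective y = let x , Fx = φ.surjective y in x , Fx G.refl

  colour-sym : ∀ {a b} → a ∈ colour G₂ b → b ∈ colour G₂ a
  colour-sym (inj₁ a≈b)  = inj₁ (H.sym a≈b)
  colour-sym {a} {b} (inj₂ a≈-b) = inj₂ (H.sym (H.trans (H.⁻¹-cong a≈-b) (H.⁻¹-involutive b)))

  colour-trans : ∀ {a b c} → a ∈ colour G₂ b → b ∈ colour G₂ c → a ∈ colour G₂ c
  colour-trans (inj₁ a≈b)  (inj₁ b≈c)  = inj₁ (H.trans a≈b b≈c)
  colour-trans (inj₁ a≈b)  (inj₂ b≈-c) = inj₂ (H.trans a≈b b≈-c)
  colour-trans (inj₂ a≈-b) (inj₁ b≈c)  = inj₂ (H.trans a≈-b (H.⁻¹-cong b≈c))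
  colour-trans (inj₂ a≈-b) (inj₂ b≈-c) = inj₁ (H.trans a≈-b
    (H.trans (H.⁻¹-cong b≈-c) (H.⁻¹-involutive _)))

  colour-≐ : ∀ {a b} → a ∈ colour G₂ b → colour G₂ a ≐ colour G₂ b
  colour-≐ a∈b = (λ x∈a → colour-trans x∈a a∈b) , (λ x∈b → colour-trans x∈b (colour-sym a∈b))

  equal-or-opposite : ∀ {a b} → a ∈ colour G₂ b → a H.≈ b ⊎ a H.+ b H.≈ H.0#
  equal-or-opposite (inj₁ a≈b)  = inj₁ a≈b
  equal-or-opposite (inj₂ a≈-b) = inj₂ (H.trans (H.∙-congʳ a≈-b) (H.inverseˡ _))

  -- A discrete derivative of `F`: for a generator `s`, `D g s` is `π s` with the sign taken at `g`.
  D : G.Carrier → G.Carrier → H.Carrier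
  D g h = F (g G.+ h) H.+ H.- F g

  F-+ : ∀ g h → F (g G.+ h) H.≈ F g H.+ D g h
  F-+ g h = H.cancel (H.inverseʳ (F g))
    (H.solve 3 (λ x y y⁻ → x ⊕ (y ⊕ y⁻) ⊜ (y ⊕ (x ⊕ y⁻)) ⊕ id) H.refl _ _ _)

  D-colour : ∀ g (s : Generator) → D g (proj₁ s) ∈ colour G₂ (π′ s)
  D-colour g s with edges g s
  ... | inj₁ eq = inj₁ (H.∙-cancelˡ (F g) _ _ (H.trans (H.sym (F-+ g (proj₁ s))) eq))
  ... | inj₂ eq = inj₂ (H.∙-cancelˡ (F g) _ _ (H.trans (H.sym (F-+ g (proj₁ s))) eq))

  D-same-colour : ∀ g h (s : Generator) → D g (proj₁ s) ∈ colour G₂ (D h (proj₁ s))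
  D-same-colour g h s = colour-trans (D-colour g s) (colour-sym (D-colour h s))

  -- An edge of colour ± π s at F h is the image of an edge at h, which has colour
  -- ± s because distinct colours stay distinct.
  colour-lifts : ∀ h (s : Generator) {c} → c ∈ colour G₂ (π′ s) →
    ∃[ t ] t ∈ colour G₁ (proj₁ s) × F (h G.+ t) H.≈ F h H.+ c
  colour-lifts h s {c} c∈ = t , t∈colour , Fh+t≈
    where
    c∈S₂ : c ∈ S₂.member
    c∈S₂ = case c∈ of λ where
      (inj₁ c≈s)  → S₂.respects (H.sym c≈s) (proj₂ (Bijection.to π s))
      (inj₂ c≈-s) → proj₂ S₂.symmetric (_ , proj₂ (Bijection.to π s) , c≈-s)

    x = proj₁ (F-surjective (F h H.+ c))
    Fx≈ = proj₂ (F-surjective (F h H.+ c))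

    h~x : ∃[ t ] t ∈ S₁.member × x G.≈ h G.+ t
    h~x = Equivalence.from (φ.adjacent h x) (c , c∈S₂ , Fx≈)

    t = proj₁ h~x
    t′ : Generator
    t′ = t , proj₁ (proj₂ h~x)

    Fh+t≈ : F (h G.+ t) H.≈ F h H.+ c
    Fh+t≈ = H.trans (φ.cong (G.sym (proj₂ (proj₂ h~x)))) Fx≈

    c≈D : c H.≈ D h t
    c≈D = H.∙-cancelˡ (F h) _ _ (H.trans (H.sym Fh+t≈) (F-+ h t))

    t∈colour : t ∈ colour G₁ (proj₁ s)
    t∈colour = proj₂ (distinct s t′ (colour-≐
      (colour-trans (colour-sym c∈) (colour-trans (inj₁ c≈D) (D-colour h t′))))) (inj₁ G.refl)

  -- The edge leading straight on from `F (g + s)` is the image of an edge from `g + s` to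
  -- `g + s + s` or to `g`. If `F` turned back at `g + s`, both ends would have image `F g`, so
  -- going straight on and turning back would coincide.
  D-straight : ∀ g (s : Generator) → D (g G.+ proj₁ s) (proj₁ s) H.≈ D g (proj₁ s)
  D-straight g s′@(s , _) with equal-or-opposite (D-same-colour (g G.+ s) g s′)
  ... | inj₁ same     = same
  ... | inj₂ opposite = H.∙-cancelˡ (F h) _ _
    (H.trans (H.sym (F-+ h s)) (H.trans Fh+s≈Fg (backward lifted)))
    where
    h = g G.+ s

    Fh+s≈Fg : F (h G.+ s) H.≈ F g
    Fh+s≈Fg = H.trans (F-+ h s) (H.cancel (H.∙-cong (H.sym (F-+ g s)) (H.sym opposite))
      (H.solve 4 (λ Fg Fh a b → (Fh ⊕ a) ⊕ ((Fg ⊕ b) ⊕ id) ⊜ Fg ⊕ (Fh ⊕ (a ⊕ b))) H.refl _ _ _ _))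

    lifted : ∃[ t ] t ∈ colour G₁ s × F (h G.+ t) H.≈ F h H.+ D g s
    lifted = colour-lifts h s′ (D-colour g s′)

    backward : (∃[ t ] t ∈ colour G₁ s × F (h G.+ t) H.≈ F h H.+ D g s) → F g H.≈ F h H.+ D g s
    backward (t , inj₁ t≈s , eq)  = H.trans (H.sym Fh+s≈Fg) (H.trans (φ.cong (G.∙-congˡ (G.sym t≈s))) eq)
    backward (t , inj₂ t≈-s , eq) = H.trans (φ.cong (G.sym (G.trans (G.∙-congˡ t≈-s)
      (G.//-rightDividesʳ s g)))) eq

  F-+-twice : ∀ g (s : Generator) →
    F (g G.+ proj₁ s G.+ proj₁ s) H.≈ F g H.+ (D g (proj₁ s) H.+ D g (proj₁ s))
  F-+-twice g s′@(s , _) = H.trans (F-+ (g G.+ s) s)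
    (H.trans (H.∙-cong (F-+ g s) (D-straight g s′)) (H.assoc _ _ _))

  -- Both sides are the increment of `F` from `g` to the opposite corner of the square spanned by
  -- `s` and `t`.
  D-cocycle : ∀ g s t → D g s H.+ D (g G.+ s) t H.≈ D g t H.+ D (g G.+ t) s
  D-cocycle g s t = H.∙-cancelˡ (F g) _ _ (H.trans (H.sym (twoStep s t))
    (H.trans (φ.cong (G.solve 3 (λ g s t → (g G.⊕ s) G.⊕ t G.⊜ (g G.⊕ t) G.⊕ s) G.refl g s t))
      (twoStep t s)))
    where
    twoStep : ∀ s t → F (g G.+ s G.+ t) H.≈ F g H.+ (D g s H.+ D (g G.+ s) t)
    twoStep s t = H.trans (F-+ (g G.+ s) t) (H.trans (H.∙-congʳ (F-+ g s)) (H.assoc _ _ _))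

  -- If the sign of s flips along t, then 2 D g s = 0 or the sign of t flips along s;
  -- the latter forces 2 D g s = 2 D g t and 2s = 2t, and comparing the images of
  -- g + 3t and g + t + 2s then gives 4 D g s = 0.
  twice-D-step : ∀ g (s t : Generator) →
    D (g G.+ proj₁ t) (proj₁ s) H.+ D (g G.+ proj₁ t) (proj₁ s) H.≈ D g (proj₁ s) H.+ D g (proj₁ s)
  twice-D-step g s′@(s , _) t′@(t , _)
    with equal-or-opposite (D-same-colour (g G.+ t) g s′)
       | equal-or-opposite (D-same-colour (g G.+ s) g t′)
  ... | inj₁ same | _ = H.∙-cong same same
  ... | inj₂ _    | inj₁ same = H.∙-cong a′≈a a′≈a
    where
    a′≈a : D (g G.+ t) s H.≈ D g s
    a′≈a = H.cancel (H.∙-cong (D-cocycle g s t) (H.sym same))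
      (H.solve 4 (λ a a′ b b′ → a′ ⊕ ((a ⊕ b′) ⊕ b) ⊜ a ⊕ ((b ⊕ a′) ⊕ b′))
        H.refl (D g s) (D (g G.+ t) s) (D g t) (D (g G.+ s) t))
  ... | inj₂ a′-opposite | inj₂ b′-opposite = H.trans 2a′≈2b (H.sym 2a≈2b)
    where
    a = D g s
    a′ = D (g G.+ t) s
    b = D g t
    b′ = D (g G.+ s) t

    2a≈2b : a H.+ a H.≈ b H.+ b
    2a≈2b = H.cancel
      (H.∙-cong (H.sym (D-cocycle g s t)) (H.∙-cong (H.sym a′-opposite) b′-opposite))
      (H.solve 4 (λ a a′ b b′ →
          (a ⊕ a) ⊕ ((b ⊕ a′) ⊕ (id ⊕ (b′ ⊕ b))) ⊜ (b ⊕ b) ⊕ ((a ⊕ b′) ⊕ ((a′ ⊕ a) ⊕ id)))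
        H.refl a a′ b b′)

    g+2s≈g+2t : g G.+ s G.+ s G.≈ g G.+ t G.+ t
    g+2s≈g+2t = φ.injective (H.trans (F-+-twice g s′)
      (H.trans (H.∙-congˡ 2a≈2b) (H.sym (F-+-twice g t′))))

    g+t+2s≈g+2t+t : g G.+ t G.+ s G.+ s G.≈ g G.+ t G.+ t G.+ t
    g+t+2s≈g+2t+t = G.trans
      (G.solve 3 (λ g s t → ((g G.⊕ t) G.⊕ s) G.⊕ s G.⊜ ((g G.⊕ s) G.⊕ s) G.⊕ t) G.refl g s t)
      (G.∙-congʳ g+2s≈g+2t)

    2a′≈2b : a′ H.+ a′ H.≈ b H.+ b
    2a′≈2b = H.∙-cancelˡ (F (g G.+ t)) _ _ (H.trans
      (H.sym (F-+-twice (g G.+ t) s′)) (H.trans (φ.cong g+t+2s≈g+2t+t)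
      (H.trans (F-+-twice (g G.+ t) t′) (H.∙-congˡ (H.∙-cong (D-straight g t′) (D-straight g t′))))))

  D-cong : ∀ {g g′} s → g G.≈ g′ → D g s H.≈ D g′ s
  D-cong s g≈g′ = H.∙-cong (φ.cong (G.∙-congʳ g≈g′)) (H.⁻¹-cong (φ.cong g≈g′))

  twice-D-constant : ∀ (s : Generator) g →
    D g (proj₁ s) H.+ D g (proj₁ s) H.≈ D G.0# (proj₁ s) H.+ D G.0# (proj₁ s)
  twice-D-constant s′@(s , _) = walk-induction _
    (λ g≈g′ eq → H.trans (H.∙-cong (D-cong s (G.sym g≈g′)) (D-cong s (G.sym g≈g′))) eq)
    H.refl
    (λ {g} t eq → H.trans (twice-D-step g s′ t) eq)

  -- Additivity of the normalised map up to doubles.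

  ψ : G.Carrier → H.Carrier
  ψ g = F g H.+ H.- F G.0#

  ψ-cong : Congruent G._≈_ H._≈_ ψ
  ψ-cong g≈g′ = H.∙-congʳ (φ.cong g≈g′)

  ψ-injective : Injective G._≈_ H._≈_ ψ
  ψ-injective = φ.injective ∘ H.∙-cancelʳ _ _ _

  ψ-surjective : ∀ y → ∃[ x ] ψ x H.≈ y
  ψ-surjective y = let x , Fx≈ = F-surjective (y H.+ F G.0#) in
    x , H.trans (H.∙-congʳ Fx≈) (H.//-rightDividesʳ _ _)

  ψ-0 : ψ G.0# H.≈ H.0#
  ψ-0 = H.inverseʳ _

  ψ-+ : ∀ g h → ψ (g G.+ h) H.≈ ψ g H.+ D g h
  ψ-+ g h = H.trans (H.∙-congʳ (F-+ g h))
    (H.solve 3 (λ x y z → (x ⊕ y) ⊕ z ⊜ (x ⊕ z) ⊕ y) H.refl _ _ _)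

  -- Induction along a walk to `h`. Replacing `h` by `h + s` changes the left side by twice the
  -- increment of `s` at `g + 2h` and the right side by twice that at `h`; these agree because
  -- doubled increments are constant.
  ψ-+-twice : ∀ h g → ψ (g G.+ (h G.+ h)) H.≈ ψ g H.+ (ψ h H.+ ψ h)
  ψ-+-twice = walk-induction _
    (λ h≈h′ eq g → H.trans (ψ-cong (G.∙-congˡ (G.∙-cong (G.sym h≈h′) (G.sym h≈h′))))
      (H.trans (eq g) (H.∙-congˡ (H.∙-cong (ψ-cong h≈h′) (ψ-cong h≈h′)))))
    (λ g → H.trans (ψ-cong (G.trans (G.∙-congˡ (G.identityˡ _)) (G.identityʳ g)))
      (H.sym (H.trans (H.∙-congˡ (H.trans (H.∙-cong ψ-0 ψ-0) (H.identityˡ _))) (H.identityʳ _))))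
    (λ {h} s′ eq g → step h s′ (eq g))
    where
    step : ∀ {g} h (s : Generator) → ψ (g G.+ (h G.+ h)) H.≈ ψ g H.+ (ψ h H.+ ψ h) →
      let k = h G.+ proj₁ s in ψ (g G.+ (k G.+ k)) H.≈ ψ g H.+ (ψ k H.+ ψ k)
    step {g} h s′@(s , _) eq =
      H.trans (ψ-cong (G.solve 3 (λ g h s →
          g G.⊕ ((h G.⊕ s) G.⊕ (h G.⊕ s)) G.⊜ ((g G.⊕ (h G.⊕ h)) G.⊕ s) G.⊕ s) G.refl g h s))
      (H.trans (H.∙-congʳ (F-+-twice m s′))
      (H.cancel
        (H.∙-cong (H.sym eq) (H.∙-cong
          (H.trans (twice-D-constant s′ h) (H.sym (twice-D-constant s′ m)))
          (H.∙-cong (ψ-+ h s) (ψ-+ h s))))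
        (H.solve 7 (λ Fm F0⁻ d ψg ψh e ψk →
            ((Fm ⊕ (d ⊕ d)) ⊕ F0⁻) ⊕ ((ψg ⊕ (ψh ⊕ ψh)) ⊕ ((e ⊕ e) ⊕ (ψk ⊕ ψk))) ⊜
            (ψg ⊕ (ψk ⊕ ψk)) ⊕ ((Fm ⊕ F0⁻) ⊕ ((d ⊕ d) ⊕ ((ψh ⊕ e) ⊕ (ψh ⊕ e)))))
          H.refl (F m) (H.- F G.0#) (D m s) (ψ g) (ψ h) (D h s) (ψ (h G.+ s)))))
      where m = g G.+ (h G.+ h)

  ψ-twice : ∀ h → ψ (h G.+ h) H.≈ ψ h H.+ ψ h
  ψ-twice h = H.trans (ψ-cong (G.sym (G.identityˡ _)))
    (H.trans (ψ-+-twice h G.0#) (H.trans (H.∙-congʳ ψ-0) (H.identityˡ _)))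

  -- Induction along a walk to `h`: a further step `s` adds to `ψ (g + h)` and `ψ h` increments that
  -- are equal or opposite.
  ψ-near-homo : ∀ h g → ∃[ w ] ψ (g G.+ h) H.≈ ψ g H.+ ψ h H.+ (w H.+ w)
  ψ-near-homo = walk-induction _
    (λ h≈h′ near g → let w , eq = near g in
      w , H.trans (ψ-cong (G.∙-congˡ (G.sym h≈h′))) (H.trans eq (H.∙-congʳ (H.∙-congˡ (ψ-cong h≈h′)))))
    (λ g → H.0# , H.trans (ψ-cong (G.identityʳ g))
      (H.cancel ψ-0 (H.solve 2 (λ a z → a ⊕ z ⊜ ((a ⊕ z) ⊕ (id ⊕ id)) ⊕ id) H.refl _ _)))
    (λ {h} s near g → step h s (near g))
    where
    step : ∀ {g} h (s : Generator) → ∃[ w ] ψ (g G.+ h) H.≈ ψ g H.+ ψ h H.+ (w H.+ w) →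
      ∃[ w ] ψ (g G.+ (h G.+ proj₁ s)) H.≈ ψ g H.+ ψ (h G.+ proj₁ s) H.+ (w H.+ w)
    step {g} h s′@(s , _) (w , eq) with equal-or-opposite (D-same-colour (g G.+ h) h s′)
    ... | inj₁ same = w , H.trans (ψ-cong (G.sym (G.assoc g h s))) (H.trans (ψ-+ (g G.+ h) s)
      (H.cancel (H.∙-cong (H.sym eq) (H.∙-cong (H.sym same) (ψ-+ h s)))
        (H.solve 7 (λ ψgh d ψg ψh w e ψk →
            (ψgh ⊕ d) ⊕ (((ψg ⊕ ψh) ⊕ (w ⊕ w)) ⊕ (e ⊕ ψk)) ⊜
            ((ψg ⊕ ψk) ⊕ (w ⊕ w)) ⊕ (ψgh ⊕ (d ⊕ (ψh ⊕ e))))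
          H.refl (ψ (g G.+ h)) (D (g G.+ h) s) (ψ g) (ψ h) w (D h s) (ψ (h G.+ s)))))
    -- Opposite increments differ by twice the first of them, which is absorbed into `w`.
    ... | inj₂ opposite = w H.+ D (g G.+ h) s , H.trans (ψ-cong (G.sym (G.assoc g h s))) (H.trans (ψ-+ (g G.+ h) s)
      (H.cancel (H.∙-cong (H.sym eq) (H.∙-cong opposite (ψ-+ h s)))
        (H.solve 7 (λ ψgh d ψg ψh w e ψk →
            (ψgh ⊕ d) ⊕ (((ψg ⊕ ψh) ⊕ (w ⊕ w)) ⊕ ((d ⊕ e) ⊕ ψk)) ⊜
            ((ψg ⊕ ψk) ⊕ ((w ⊕ d) ⊕ (w ⊕ d))) ⊕ (ψgh ⊕ (id ⊕ (ψh ⊕ e))))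
          H.refl (ψ (g G.+ h)) (D (g G.+ h) s) (ψ g) (ψ h) w (D h s) (ψ (h G.+ s)))))

corollary1p3 : (∀ {ℓ} → ExcludedMiddle ℓ) →
    (∀ {a ℓ₁ b ℓ₂} → Choice a ℓ₁ b ℓ₂) →
    ∀ {c₁ ℓ₁ c₂ ℓ₂ p₁ p₂}
    (G₁ : AbelianGroup c₁ ℓ₁) (G₂ : AbelianGroup c₂ ℓ₂)
    (S₁ : SymmetricSubset G₁ p₁) (S₂ : SymmetricSubset G₂ p₂) →
    Connected (Cay G₁ S₁) →
    (φ : GraphIso (Cay G₁ S₁) (Cay G₂ S₂)) →
    Chromatic G₁ S₁ G₂ S₂ φ →
    G₁ ≅ G₂
corollary1p3 em choice G₁ G₂ S₁ S₂ connected φ chromatic =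
  Straightening.straighten em choice G₁ G₂ ψ ψ-cong ψ-injective ψ-surjective ψ-0 ψ-twice
    (λ g h → AbelianGroup.trans G₂ (ψ-+-twice h g)
      (AbelianGroup.∙-congˡ G₂ (AbelianGroup.sym G₂ (ψ-twice h))))
    (λ g h → ψ-near-homo h g)
  where open ChromaticIso G₁ G₂ S₁ S₂ connected φ chromatic
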